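{- For any integer $\gamma \geq 0$, as a set-operad, the underlying set of $\mathsf{Trias}_\gamma$ is the set of all words on the alphabet $\{0, 1, \dots, \gamma\}$ containing at least one occurrence of $0$.
   Context: Write $[\gamma] = \{1, \dots, \gamma\}$. A set-operad is a nonsymmetric operad in sets, described by partial compositions $\circ_i$ and a unit. Let $\mathcal{M}_\gamma$ be the monoid on $\{0\} \cup [\gamma]$ with product $\max$, and let $\mathsf{T}\mathcal{M}_\gamma$ be the set-operad whose elements of arity $n \ge 1$ are all words of length $n$ on $\{0\} \cup [\gamma]$, with partial compositions $u \circ_i v := u_1 \dots u_{i-1}\,\max(u_i, v_1) \dots \max(u_i, v_m)\, u_{i+1} \dots u_n$ (for words $u,v$ of lengths $n,m$) and unit the one-letter word $0$. $\mathsf{Trias}_\gamma$ is the suboperad of $\mathsf{T}\mathcal{M}_\gamma$ generated by the two-letter words $\{0a, 00, a0 : a \in [\gamma]\}$, i.e. the smallest set of words containing these and the unit $0$ and closed under all partial compositions. -}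

module Defs where

open import Algebra.Structures using (IsMonoid)
open import Data.Fin.Base as Fin using (Fin; zero; suc; toℕ)
open import Data.Fin.Properties using (≤-totalOrder; toℕ-injective; toℕ-cast)
open import Data.List.Base as List using (List; []; _∷_; _++_; take; drop; lookup)
open import Data.List.Properties using (++-assoc; map-++; map-∘; map-cong; map-id; length-++; length-map)
open import Data.List.NonEmpty as List⁺ using (List⁺; _∷_; toList; _++⁺_; _⁺++_; [_])
open import Data.Nat.Base using (ℕ; zero; suc; _+_; _<_; z≤n; s≤s; s<s⁻¹)
open import Data.Nat.Properties using (suc-injective; +-comm)
open import Relation.Binary.PropositionalEquality
  using (_≡_; refl; sym; trans; cong; cong₂; module ≡-Reasoning)
open import Level using (0ℓ)
open import Relation.Unary using (Pred; _⊆_)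
import Algebra.Construct.NaturalChoice.Max as Max

-- A nonsymmetric operad in sets, presented as its set of all elements together
-- with the arity map.  Positions are 0-based: the partial composition ∘ᵢ of
-- the literature (1 ≤ i ≤ arity) is ∘[ i − 1 ].  The positions k and l in the associativity laws live in the arity
-- of a composite, so they are specified by their values.
record SetOperad : Set₁ where
  infixl 7 _∘[_]_
  field
    Carrier : Set
    arity   : Carrier → ℕ
    _∘[_]_  : (x : Carrier) → Fin (arity x) → Carrier → Carrier
    unit    : Carrier

    arity-unit : arity unit ≡ 1
    arity-∘    : ∀ x i y → suc (arity (x ∘[ i ] y)) ≡ arity x + arity y

    unitˡ : ∀ i x → unit ∘[ i ] x ≡ x
    unitʳ : ∀ x i → x ∘[ i ] unit ≡ x

    assoc-sequential : ∀ x y z i j k → toℕ k ≡ toℕ i + toℕ j →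
                       (x ∘[ i ] y) ∘[ k ] z ≡ x ∘[ i ] (y ∘[ j ] z)
    assoc-parallel   : ∀ x y z i j k l → toℕ i < toℕ j →
                       toℕ k ≡ toℕ i → suc (toℕ l) ≡ toℕ j + arity z →
                       (x ∘[ j ] y) ∘[ k ] z ≡ (x ∘[ i ] z) ∘[ l ] y

record Suboperad (O : SetOperad) : Set₁ where
  open SetOperad O
  field
    underlyingSet : Pred Carrier 0ℓ
    unit-closed   : underlyingSet unit
    ∘-closed      : ∀ {x y} i → underlyingSet x → underlyingSet y →
                    underlyingSet (x ∘[ i ] y)

open Suboperad public using (underlyingSet)

module _ (O : SetOperad) where
  open SetOperad O

  data Closure (G : Pred Carrier 0ℓ) : Pred Carrier 0ℓ where
    generator   : ∀ {x} → G x → Closure G x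
    identity    : Closure G unit
    composition : ∀ {x y} i → Closure G x → Closure G y → Closure G (x ∘[ i ] y)

  generatedBy : Pred Carrier 0ℓ → Suboperad O
  generatedBy G = record
    { underlyingSet = Closure G
    ; unit-closed   = identity
    ; ∘-closed      = composition
    }

  generatedBy-smallest : ∀ {G} (S : Suboperad O) → G ⊆ underlyingSet S →
                         underlyingSet (generatedBy G) ⊆ underlyingSet S
  generatedBy-smallest S G⊆S (generator g)         = G⊆S g
  generatedBy-smallest S G⊆S identity              = Suboperad.unit-closed S
  generatedBy-smallest S G⊆S (composition i cx cy) =
    Suboperad.∘-closed S i (generatedBy-smallest S G⊆S cx) (generatedBy-smallest S G⊆S cy)

module _ {A : Set} {_∙_ : A → A → A} {ε : A} (isMonoid : IsMonoid _≡_ _∙_ ε) where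

  substitute : (u : List⁺ A) → Fin (List⁺.length u) → List⁺ A → List⁺ A
  substitute u i v =
    take (toℕ i) (toList u)
      ++⁺ (List⁺.map (lookup (toList u) i ∙_) v ⁺++ drop (suc (toℕ i)) (toList u))

  private
    module M = IsMonoid isMonoid

    subL : (us : List A) → Fin (List.length us) → List A → List A
    subL us i vs = take (toℕ i) us ++ (List.map (lookup us i ∙_) vs ++ drop (suc (toℕ i)) us)

    toList-++⁺ : (xs : List A) (ys : List⁺ A) → toList (xs ++⁺ ys) ≡ xs ++ toList ys
    toList-++⁺ []       ys = refl
    toList-++⁺ (x ∷ xs) ys = cong (x ∷_) (toList-++⁺ xs ys)

    toList-substitute : ∀ u i v → toList (substitute u i v) ≡ subL (toList u) i (toList v)
    toList-substitute u i v = toList-++⁺ (take (toℕ i) (toList u)) _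

    toList-injective : ∀ {u v : List⁺ A} → toList u ≡ toList v → u ≡ v
    toList-injective refl = refl

    subL-cong : ∀ {us us′ vs vs′} i i′ → us ≡ us′ → toℕ i ≡ toℕ i′ → vs ≡ vs′ →
                subL us i vs ≡ subL us′ i′ vs′
    subL-cong i i′ refl i≡i′ refl with toℕ-injective i≡i′
    ... | refl = refl

    length-subL : ∀ us i vs → suc (List.length (subL us i vs)) ≡ List.length us + List.length vs
    length-subL (x ∷ us) zero    vs = cong suc (begin
      List.length (List.map (x ∙_) vs ++ us)               ≡⟨ length-++ (List.map (x ∙_) vs) ⟩
      List.length (List.map (x ∙_) vs) + List.length us    ≡⟨ cong (_+ List.length us) (length-map (x ∙_) vs) ⟩
      List.length vs + List.length us                      ≡⟨ +-comm (List.length vs) _ ⟩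
      List.length us + List.length vs                      ∎)
      where open ≡-Reasoning
    length-subL (x ∷ us) (suc i) vs = cong suc (length-subL us i vs)

    subL-identityʳ : ∀ us i → subL us i (ε ∷ []) ≡ us
    subL-identityʳ (x ∷ us) zero    = cong (_∷ us) (M.identityʳ x)
    subL-identityʳ (x ∷ us) (suc i) = cong (x ∷_) (subL-identityʳ us i)

    subL-identityˡ : ∀ i vs → subL (ε ∷ []) i vs ≡ vs
    subL-identityˡ zero []       = refl
    subL-identityˡ zero (v ∷ vs) = cong₂ _∷_ (M.identityˡ v) (subL-identityˡ zero vs)

    map-∙-∙ : ∀ x y ws → List.map ((x ∙ y) ∙_) ws ≡ List.map (x ∙_) (List.map (y ∙_) ws)
    map-∙-∙ x y ws = trans (map-cong (M.assoc x y) ws) (map-∘ ws)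

    subL-map-++ : ∀ x us vs j ws k → toℕ k ≡ toℕ j →
                  subL (List.map (x ∙_) vs ++ us) k ws ≡ List.map (x ∙_) (subL vs j ws) ++ us
    subL-map-++ x us (y ∷ vs) zero    ws zero    eq = begin
      List.map ((x ∙ y) ∙_) ws ++ (List.map (x ∙_) vs ++ us)
        ≡⟨ cong (_++ (List.map (x ∙_) vs ++ us)) (map-∙-∙ x y ws) ⟩
      List.map (x ∙_) (List.map (y ∙_) ws) ++ (List.map (x ∙_) vs ++ us)
        ≡⟨ ++-assoc (List.map (x ∙_) (List.map (y ∙_) ws)) _ us ⟨
      (List.map (x ∙_) (List.map (y ∙_) ws) ++ List.map (x ∙_) vs) ++ us
        ≡⟨ cong (_++ us) (map-++ (x ∙_) (List.map (y ∙_) ws) vs) ⟨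
      List.map (x ∙_) (List.map (y ∙_) ws ++ vs) ++ us ∎
      where open ≡-Reasoning
    subL-map-++ x us (y ∷ vs) (suc j) ws (suc k) eq =
      cong ((x ∙ y) ∷_) (subL-map-++ x us vs j ws k (suc-injective eq))

    subL-sequential : ∀ us vs ws i j k → toℕ k ≡ toℕ i + toℕ j →
                      subL (subL us i vs) k ws ≡ subL us i (subL vs j ws)
    subL-sequential (x ∷ us) vs ws zero    j k       eq = subL-map-++ x us vs j ws k eq
    subL-sequential (x ∷ us) vs ws (suc i) j (suc k) eq =
      cong (x ∷_) (subL-sequential us vs ws i j k (suc-injective eq))

    subL-++ʳ : ∀ as us j vs l → toℕ l ≡ List.length as + toℕ j →
               subL (as ++ us) l vs ≡ as ++ subL us j vs
    subL-++ʳ []       us j vs l       eq = subL-cong l j refl eq refl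
    subL-++ʳ (a ∷ as) us j vs (suc l) eq = cong (a ∷_) (subL-++ʳ as us j vs l (suc-injective eq))

    subL-parallel : ∀ us vs ws i j k l → toℕ i < toℕ j →
                    toℕ k ≡ toℕ i → suc (toℕ l) ≡ toℕ j + List.length ws →
                    subL (subL us j vs) k ws ≡ subL (subL us i ws) l vs
    subL-parallel (x ∷ us) vs ws zero (suc j) zero l i<j k≡i l≡ =
      sym (subL-++ʳ (List.map (x ∙_) ws) us j vs l (begin
        toℕ l                                     ≡⟨ suc-injective l≡ ⟩
        toℕ j + List.length ws                    ≡⟨ +-comm (toℕ j) _ ⟩
        List.length ws + toℕ j                    ≡⟨ cong (_+ toℕ j) (length-map (x ∙_) ws) ⟨
        List.length (List.map (x ∙_) ws) + toℕ j  ∎))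
      where open ≡-Reasoning
    subL-parallel (x ∷ us) vs ws (suc i) (suc j) (suc k) (suc l) i<j k≡i l≡ =
      cong (x ∷_) (subL-parallel us vs ws i j k l (s<s⁻¹ i<j) (suc-injective k≡i) (suc-injective l≡))
    subL-parallel (x ∷ y ∷ us) vs ws (suc i) (suc zero) (suc k) zero (s≤s ())
    subL-parallel (x ∷ y ∷ us) vs ws (suc i) (suc (suc j)) (suc k) zero i<j k≡i ()

    toList-substitute² : ∀ u i v k w (k′ : Fin (List.length (subL (toList u) i (toList v)))) →
      toℕ k ≡ toℕ k′ →
      toList (substitute (substitute u i v) k w) ≡ subL (subL (toList u) i (toList v)) k′ (toList w)
    toList-substitute² u i v k w k′ eq =
      trans (toList-substitute (substitute u i v) k w)
            (subL-cong k k′ (toList-substitute u i v) eq refl)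

    castPos : ∀ u i v → Fin (List⁺.length (substitute u i v)) →
              Fin (List.length (subL (toList u) i (toList v)))
    castPos u i v = Fin.cast (cong List.length (toList-substitute u i v))

    castPos-toℕ : ∀ u i v k → toℕ (castPos u i v k) ≡ toℕ k
    castPos-toℕ u i v = toℕ-cast (cong List.length (toList-substitute u i v))

  T : SetOperad
  T = record
    { Carrier    = List⁺ A
    ; arity      = List⁺.length
    ; _∘[_]_     = substitute
    ; unit       = [ ε ]
    ; arity-unit = refl
    ; arity-∘    = λ u i v →
        trans (cong (λ xs → suc (List.length xs)) (toList-substitute u i v))
              (length-subL (toList u) i (toList v))
    ; unitˡ = λ i v → toList-injective
        (trans (toList-substitute [ ε ] i v) (subL-identityˡ i (toList v)))
    ; unitʳ = λ u i → toList-injective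
        (trans (toList-substitute u i [ ε ]) (subL-identityʳ (toList u) i))
    ; assoc-sequential = λ u v w i j k k≡ → toList-injective
        (trans (toList-substitute² u i v k w (castPos u i v k) (sym (castPos-toℕ u i v k)))
        (trans (subL-sequential (toList u) (toList v) (toList w) i j (castPos u i v k)
                 (trans (castPos-toℕ u i v k) k≡))
        (sym (trans (toList-substitute u i (substitute v j w))
                    (subL-cong {us = toList u} i i refl refl (toList-substitute v j w))))))
    ; assoc-parallel = λ u v w i j k l i<j k≡ l≡ → toList-injective
        (trans (toList-substitute² u j v k w (castPos u j v k) (sym (castPos-toℕ u j v k)))
        (trans (subL-parallel (toList u) (toList v) (toList w) i j (castPos u j v k) (castPos u i w l) i<j
                 (trans (castPos-toℕ u j v k) k≡)
                 (trans (cong suc (castPos-toℕ u i w l)) l≡))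
        (sym (toList-substitute² u i w l v (castPos u i w l) (sym (castPos-toℕ u i w l))))))
    }

-- The alphabet {0} ∪ [γ]: the letter 0 is zero, and the elements of [γ] are the
-- letters suc a with a : Fin γ.
Letter : ℕ → Set
Letter γ = Fin (suc γ)

Word : ℕ → Set
Word γ = List⁺ (Letter γ)

module _ (γ : ℕ) where

  open Max (≤-totalOrder (suc γ)) using (_⊔_; ⊔-isMonoid)

  max-isMonoid : IsMonoid _≡_ _⊔_ zero
  max-isMonoid = ⊔-isMonoid (λ _ → z≤n)

  TM : SetOperad
  TM = T max-isMonoid

  -- The word 00 is a generator for every γ, including γ = 0, where no letter a ∈ [γ] exists.
  data Generator : Pred (Word γ) 0ℓ where
    gen-0a : (a : Fin γ) → Generator (zero ∷ suc a ∷ [])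
    gen-00 : Generator (zero ∷ zero ∷ [])
    gen-a0 : (a : Fin γ) → Generator (suc a ∷ zero ∷ [])

  Trias : Suboperad TM
  Trias = generatedBy TM Generator

{-# OPTIONS --safe #-}
-- Substituting v into a letter 0 leaves v unchanged, and substituting elsewhere keeps the zeros of u,
-- so the words containing 0 form a suboperad.  Conversely, a word p 0 w is built from the word 0
-- by inserting the letters of w with 0w ∘₁ 0b = 0bw, then prepending those of p with a0 ∘₂ v = av.
module Submission where

open import Defs
open import Algebra.Structures using (IsMonoid)
open import Data.Nat.Base using (ℕ)
open import Data.Fin.Base using (zero; suc)
open import Data.List.Base as List using ([]; _∷_)
open import Data.List.Properties using (++-identityʳ; map-cong; map-id)
open import Data.List.NonEmpty using (_∷_; toList)
open import Data.List.Membership.Propositional using (_∈_)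
open import Data.List.Membership.Propositional.Properties using (∈-++⁺ˡ; ∈-++⁺ʳ)
open import Data.List.Relation.Unary.Any using (here; there)
open import Data.Product.Base using (_,_)
open import Relation.Binary.PropositionalEquality using (_≡_; refl; sym; trans; cong; cong₂; subst)
open import Relation.Unary using (_≐_; _⊆_)

module _ {A : Set} {_∙_ : A → A → A} {ε : A} (isMonoid : IsMonoid _≡_ _∙_ ε) where

  open IsMonoid isMonoid using (identityˡ)

  map-ε∙ : ∀ xs → List.map (ε ∙_) xs ≡ xs
  map-ε∙ xs = trans (map-cong identityˡ xs) (map-id xs)

  -- The inserted copy of `v` is only multiplied by `ε`, and nothing follows it, whence
  -- `++-identityʳ`.
  substitute-aε : ∀ a v → substitute isMonoid (a ∷ ε ∷ []) (suc zero) v ≡ a ∷ toList v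
  substitute-aε a v =
    cong (a ∷_) (trans (++-identityʳ (List.map (ε ∙_) (toList v))) (map-ε∙ (toList v)))

  -- A leading `ε` remains after the insertion, so the step can be iterated.
  substitute-εb : ∀ xs b → substitute isMonoid (ε ∷ xs) zero (ε ∷ b ∷ []) ≡ ε ∷ b ∷ xs
  substitute-εb xs b = cong₂ (λ c d → c ∷ d ∷ xs) (identityˡ ε) (identityˡ b)

  ε∈-substitute : ∀ u i v → ε ∈ toList u → ε ∈ toList v → ε ∈ toList (substitute isMonoid u i v)
  -- The replaced letter is this `ε`, so `v` is copied unchanged and supplies the occurrence.
  ε∈-substitute (_ ∷ _)      zero    v (here refl) ε∈v =
    ∈-++⁺ˡ (subst (ε ∈_) (sym (map-ε∙ (toList v))) ε∈v)
  -- This `ε` lies to the right of the replaced letter and survives in the tail.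
  ε∈-substitute (x ∷ _)      zero    v (there ε∈u) _   = ∈-++⁺ʳ (List.map (x ∙_) (toList v)) ε∈u
  ε∈-substitute (_ ∷ _ ∷ _)  (suc i) v (here ε≡x)  _   = here ε≡x
  ε∈-substitute (_ ∷ y ∷ us) (suc i) v (there ε∈u) ε∈v = there (ε∈-substitute (y ∷ us) i v ε∈u ε∈v)

  wordsContainingε : Suboperad (T isMonoid)
  wordsContainingε = record
    { underlyingSet = λ w → ε ∈ toList w
    ; unit-closed   = here refl
    ; ∘-closed      = λ {u} {v} i → ε∈-substitute u i v
    }

module _ (γ : ℕ) where

  generator-contains-zero : Generator γ ⊆ λ w → zero ∈ toList w
  generator-contains-zero (gen-0a _) = here refl
  generator-contains-zero gen-00     = here refl
  generator-contains-zero (gen-a0 _) = there (here refl)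

  -- Treats all letters uniformly: `gen-00` covers the letter 0, which lies outside [γ].
  0a-generator : ∀ a → Generator γ (zero ∷ a ∷ [])
  0a-generator zero    = gen-00
  0a-generator (suc a) = gen-0a a

  a0-generator : ∀ a → Generator γ (a ∷ zero ∷ [])
  a0-generator zero    = gen-00
  a0-generator (suc a) = gen-a0 a

  Trias-prepend : ∀ a v → underlyingSet (Trias γ) v → underlyingSet (Trias γ) (a ∷ toList v)
  Trias-prepend a v t =
    subst (underlyingSet (Trias γ)) (substitute-aε (max-isMonoid γ) a v)
          (composition (suc zero) (generator (a0-generator a)) t)

  -- Each new letter enters directly after the leading 0, so `xs` is built from right to left.
  Trias-zero∷ : ∀ xs → underlyingSet (Trias γ) (zero ∷ xs)
  Trias-zero∷ []       = identity
  Trias-zero∷ (b ∷ xs) =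
    subst (underlyingSet (Trias γ)) (substitute-εb (max-isMonoid γ) xs b)
          (composition zero (Trias-zero∷ xs) (generator (0a-generator b)))

  -- Recursion on the membership proof, which singles out one 0: the letters before it are
  -- prepended, and the rest is a word starting with 0.
  contains-zero⇒Trias : ∀ x xs → zero ∈ x ∷ xs → underlyingSet (Trias γ) (x ∷ xs)
  contains-zero⇒Trias _ xs       (here refl) = Trias-zero∷ xs
  contains-zero⇒Trias x (y ∷ ys) (there 0∈)  =
    Trias-prepend x (y ∷ ys) (contains-zero⇒Trias y ys 0∈)

proposition4p1p1 : (γ : ℕ) → underlyingSet (Trias γ) ≐ (λ (w : Word γ) → zero ∈ toList w)
proposition4p1p1 γ =
  generatedBy-smallest (TM γ) (wordsContainingε (max-isMonoid γ)) (generator-contains-zero γ) ,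
  λ { {x ∷ xs} → contains-zero⇒Trias γ x xs }
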